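{- Let $n>2$ and $t>2$ be two positive integers. Then \[\varphi(C_n \boxdot C_t) = \begin{cases} 5, & \text{if } n\in\{3,4\},\\ n, & \text{if } 5\leq n\leq 2t+2,\\ 2t+3, & \text{otherwise}. \end{cases}\]
   Context: All graphs are finite and simple. $C_n$ denotes the cycle with $n$ vertices. The subdivision graph $S(G)$ of a graph $G$ is obtained by inserting one new vertex into every edge of $G$. For graphs $G$ and $H$, with $V(G)=\{u_0,\ldots,u_{m-1}\}$, the subdivision-vertex neighbourhood corona (SVN corona) $G\boxdot H$ is the graph obtained from $S(G)$ by adding $m$ vertex-disjoint copies of $H$ (one for each $u_i$) and joining, for each $i$, every vertex of $N_{S(G)}(u_i)$ (the neighbourhood of $u_i$ in $S(G)$) to every vertex of the copy of $H$ associated with $u_i$. A $b$-chromatic coloring of a graph with $k$ colors is a proper coloring with colors $0,\ldots,k-1$ such that, for each color $i$, there is a vertex (a $b$-vertex) of color $i$ having, for each color $j\neq i$, a neighbour of color $j$. The $b$-chromatic number $\varphi(G)$ is the maximum $k$ for which $G$ has a $b$-chromatic coloring with $k$ colors. -}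

module Defs where

open import Data.Empty using (⊥)
open import Data.Fin using (Fin; zero; suc; toℕ; _<_)
open import Data.Fin.Properties using (+↔⊎; *↔×; _<?_; inj⇒≟)
open import Data.Irrelevant using ([_])
open import Data.Nat as ℕ using (ℕ; _≤_)
open import Data.Nat.Properties as ℕ using (1+n≢n; <⇒≢)
open import Data.Product using (∃-syntax; _×_; _,_; proj₁; proj₂)
open import Data.Product.Function.NonDependent.Propositional using (_×-↔_)
open import Data.Refinement
  using (Refinement-syntax; value; value-injective; _,_)
open import Data.Sum using (_⊎_; inj₁; inj₂; swap)
open import Data.Sum.Function.Propositional using (_⊎-↔_)
open import Function.Base using (_∘_)
open import Function.Bundles using (_↔_; mk↔ₛ′; module Inverse)
open import Function.Properties.Inverse using (↔-refl; ↔-sym; ↔-trans; ↔⇒↣)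
open import Relation.Binary.Definitions using (DecidableEquality)
open import Relation.Binary.PropositionalEquality
  using (_≡_; _≢_; refl; sym; trans; cong; subst)
open import Relation.Nullary using (¬_; Dec; yes; no; contradiction-irr)
open import Relation.Nullary.Decidable using (_×-dec_; _⊎-dec_)
open import Relation.Unary using (Decidable)

Finite : Set → Set
Finite A = ∃[ n ] (A ↔ Fin n)

finite⇒≟ : {A : Set} → Finite A → DecidableEquality A
finite⇒≟ (_ , A↔Fin) = inj⇒≟ (↔⇒↣ A↔Fin)

finite-⊎ : {A B : Set} → Finite A → Finite B → Finite (A ⊎ B)
finite-⊎ (m , f) (n , g) = m ℕ.+ n , ↔-trans (f ⊎-↔ g) (↔-sym +↔⊎)

finite-× : {A B : Set} → Finite A → Finite B → Finite (A × B)
finite-× (m , f) (n , g) = m ℕ.* n , ↔-trans (f ×-↔ g) (↔-sym *↔×)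

finite-refinement-Fin : ∀ n {P : Fin n → Set} → Decidable P →
                        Finite [ i ∈ Fin n ∣ P i ]
finite-refinement-Fin ℕ.zero P? = 0 , mk↔ₛ′ (λ ()) (λ ()) (λ ()) (λ ())
finite-refinement-Fin (ℕ.suc n) {P} P?
  with P? zero | finite-refinement-Fin n (P? ∘ suc)
... | yes p | m , f = ℕ.suc m , mk↔ₛ′ to from to∘from from∘to
  where
  module F = Inverse f
  to : [ i ∈ Fin (ℕ.suc n) ∣ P i ] → Fin (ℕ.suc m)
  to (zero  , _) = zero
  to (suc i , q) = suc (F.to (i , q))
  from : Fin (ℕ.suc m) → [ i ∈ Fin (ℕ.suc n) ∣ P i ]
  from zero    = zero , [ p ]
  from (suc k) with F.from k
  ... | i , q = suc i , q
  to∘from : ∀ k → to (from k) ≡ k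
  to∘from zero    = refl
  to∘from (suc k) = cong suc (F.strictlyInverseˡ k)
  from∘to : ∀ v → from (to v) ≡ v
  from∘to (zero  , _) = refl
  from∘to (suc i , q) =
    value-injective (cong (suc ∘ value) (F.strictlyInverseʳ (i , q)))
... | no ¬p | m , f = m , mk↔ₛ′ to from to∘from from∘to
  where
  module F = Inverse f
  to : [ i ∈ Fin (ℕ.suc n) ∣ P i ] → Fin m
  to (zero  , [ q ]) = contradiction-irr q ¬p
  to (suc i , q)     = F.to (i , q)
  from : Fin m → [ i ∈ Fin (ℕ.suc n) ∣ P i ]
  from k with F.from k
  ... | i , q = suc i , q
  to∘from : ∀ k → to (from k) ≡ k
  to∘from k = F.strictlyInverseˡ k
  from∘to : ∀ v → from (to v) ≡ v
  from∘to (zero  , [ q ]) = contradiction-irr q ¬p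
  from∘to (suc i , q)     =
    value-injective (cong (suc ∘ value) (F.strictlyInverseʳ (i , q)))

finite-refinement : {A : Set} {P : A → Set} → Finite A → Decidable P →
                    Finite [ x ∈ A ∣ P x ]
finite-refinement {A} {P} (n , f) P?
  with finite-refinement-Fin n (P? ∘ Inverse.from f)
... | m , g = m , ↔-trans refined g
  where
  module F = Inverse f
  refined : [ x ∈ A ∣ P x ] ↔ [ i ∈ Fin n ∣ P (F.from i) ]
  refined = mk↔ₛ′
    (λ { (x , [ p ]) → F.to x , [ subst P (sym (F.strictlyInverseʳ x)) p ] })
    (λ { (i , p) → F.from i , p })
    (λ { (i , _) → value-injective (F.strictlyInverseˡ i) })
    (λ { (x , _) → value-injective (F.strictlyInverseʳ x) })

record Graph : Set₁ where
  infix 4 _~_ _~?_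
  field
    Vertex   : Set
    finite   : Finite Vertex
    _~_      : Vertex → Vertex → Set
    _~?_     : ∀ u v → Dec (u ~ v)
    ~-sym    : ∀ {u v} → u ~ v → v ~ u
    ~-irrefl : ∀ {v} → ¬ (v ~ v)

  _≟_ : DecidableEquality Vertex
  _≟_ = finite⇒≟ finite

  index : Vertex → Fin (proj₁ finite)
  index = Inverse.to (proj₂ finite)

  -- An unordered pair {u , v} of adjacent vertices is represented by its
  -- increasing ordering with respect to the enumeration of the vertices.
  -- The proof component is irrelevant, so each edge is counted once.
  Edge : Set
  Edge = [ e ∈ Vertex × Vertex
         ∣ index (proj₁ e) < index (proj₂ e) × proj₁ e ~ proj₂ e ]

  finite-Edge : Finite Edge
  finite-Edge = finite-refinement (finite-× finite finite)
    (λ { (u , v) → (index u <? index v) ×-dec (u ~? v) })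

  infix 4 _∈ₑ_ _∈ₑ?_

  _∈ₑ_ : Vertex → Edge → Set
  v ∈ₑ e = v ≡ proj₁ (value e) ⊎ v ≡ proj₂ (value e)

  _∈ₑ?_ : ∀ v e → Dec (v ∈ₑ e)
  v ∈ₑ? e = (v ≟ proj₁ (value e)) ⊎-dec (v ≟ proj₂ (value e))

-- For n ≤ 2 there is no simple graph that is a cycle on n vertices.
cycle : (n : ℕ) → 2 ℕ.< n → Graph
cycle n n>2 = record
  { Vertex   = Fin n
  ; finite   = n , ↔-refl
  ; _~_      = λ i j → Next i j ⊎ Next j i
  ; _~?_     = λ i j → next? i j ⊎-dec next? j i
  ; ~-sym    = swap
  ; ~-irrefl = λ { (inj₁ p) → next-irrefl p ; (inj₂ p) → next-irrefl p }
  }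
  where
  Next : Fin n → Fin n → Set
  Next i j = ℕ.suc (toℕ i) ≡ toℕ j ⊎ (ℕ.suc (toℕ i) ≡ n × toℕ j ≡ 0)

  next? : ∀ i j → Dec (Next i j)
  next? i j = (ℕ.suc (toℕ i) ℕ.≟ toℕ j)
        ⊎-dec ((ℕ.suc (toℕ i) ℕ.≟ n) ×-dec (toℕ j ℕ.≟ 0))

  next-irrefl : ∀ {i} → ¬ Next i i
  next-irrefl (inj₁ 1+i≡i)         = 1+n≢n 1+i≡i
  next-irrefl (inj₂ (1+i≡n , i≡0)) =
    <⇒≢ (ℕ.<-trans (ℕ.n<1+n 1) n>2) (trans (cong ℕ.suc (sym i≡0)) 1+i≡n)

subdivision : Graph → Graph
subdivision G = record
  { Vertex   = Vertex ⊎ Edge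
  ; finite   = finite-⊎ finite finite-Edge
  ; _~_      = _~ₛ_
  ; _~?_     = dec
  ; ~-sym    = λ {x} {y} → symmetric x y
  ; ~-irrefl = λ {x} → irreflexive x
  }
  where
  open Graph G

  _~ₛ_ : Vertex ⊎ Edge → Vertex ⊎ Edge → Set
  inj₁ u ~ₛ inj₁ v = ⊥
  inj₁ u ~ₛ inj₂ e = u ∈ₑ e
  inj₂ e ~ₛ inj₁ u = u ∈ₑ e
  inj₂ e ~ₛ inj₂ f = ⊥

  dec : ∀ x y → Dec (x ~ₛ y)
  dec (inj₁ u) (inj₁ v) = no λ ()
  dec (inj₁ u) (inj₂ e) = u ∈ₑ? e
  dec (inj₂ e) (inj₁ u) = u ∈ₑ? e
  dec (inj₂ e) (inj₂ f) = no λ ()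

  symmetric : ∀ x y → x ~ₛ y → y ~ₛ x
  symmetric (inj₁ u) (inj₂ e) u∈e = u∈e
  symmetric (inj₂ e) (inj₁ u) u∈e = u∈e

  irreflexive : ∀ x → ¬ (x ~ₛ x)
  irreflexive (inj₁ u) ()
  irreflexive (inj₂ e) ()

-- The subdivision-vertex neighbourhood corona.  The vertex inj₂ (u , h)
-- is the vertex h of the copy of H associated with u.
infixl 6 _⊡_
_⊡_ : Graph → Graph → Graph
G ⊡ H = record
  { Vertex   = S.Vertex ⊎ (G.Vertex × H.Vertex)
  ; finite   = finite-⊎ S.finite (finite-× G.finite H.finite)
  ; _~_      = _~ᶜ_
  ; _~?_     = dec
  ; ~-sym    = λ {x} {y} → symmetric x y
  ; ~-irrefl = λ {x} → irreflexive x
  }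
  where
  module G = Graph G
  module H = Graph H
  module S = Graph (subdivision G)

  V : Set
  V = S.Vertex ⊎ (G.Vertex × H.Vertex)

  _~ᶜ_ : V → V → Set
  inj₁ x       ~ᶜ inj₁ y       = x S.~ y
  inj₁ x       ~ᶜ inj₂ (u , h) = inj₁ u S.~ x
  inj₂ (u , h) ~ᶜ inj₁ x       = inj₁ u S.~ x
  inj₂ (u , h) ~ᶜ inj₂ (v , k) = u ≡ v × h H.~ k

  dec : ∀ x y → Dec (x ~ᶜ y)
  dec (inj₁ x)       (inj₁ y)       = x S.~? y
  dec (inj₁ x)       (inj₂ (u , h)) = inj₁ u S.~? x
  dec (inj₂ (u , h)) (inj₁ x)       = inj₁ u S.~? x
  dec (inj₂ (u , h)) (inj₂ (v , k)) = (u G.≟ v) ×-dec (h H.~? k)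

  symmetric : ∀ x y → x ~ᶜ y → y ~ᶜ x
  symmetric (inj₁ x)       (inj₁ y)       p         = S.~-sym {x} {y} p
  symmetric (inj₁ x)       (inj₂ (u , h)) p         = p
  symmetric (inj₂ (u , h)) (inj₁ x)       p         = p
  symmetric (inj₂ (u , h)) (inj₂ (v , k)) (u≡v , p) = sym u≡v , H.~-sym p

  irreflexive : ∀ x → ¬ (x ~ᶜ x)
  irreflexive (inj₁ x)       p       = S.~-irrefl {x} p
  irreflexive (inj₂ (u , h)) (_ , p) = H.~-irrefl p

module _ (G : Graph) where
  open Graph G

  IsProper : ∀ {k} → (Vertex → Fin k) → Set
  IsProper c = ∀ {u v} → u ~ v → c u ≢ c v

  IsBVertex : ∀ {k} → (Vertex → Fin k) → Vertex → Set
  IsBVertex c v = ∀ j → j ≢ c v → ∃[ w ] (v ~ w × c w ≡ j)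

  IsBColoring : ∀ {k} → (Vertex → Fin k) → Set
  IsBColoring c = IsProper c × (∀ i → ∃[ v ] (c v ≡ i × IsBVertex c v))

  HasBColoring : ℕ → Set
  HasBColoring k = ∃[ c ] IsBColoring {k} c

  -- The relation φ(G) = k.
  HasBChromaticNumber : ℕ → Set
  HasBChromaticNumber k =
    HasBColoring k × (∀ l → HasBColoring l → l ≤ k)

{-# OPTIONS --safe #-}

-- Write e_i for the subdivision vertex between u_i and u_{i+1}.  The vertices
-- u_i have degree 2, those of the copies degree 4 and the e_i degree 2t + 2, so
-- with at least six colours all b-vertices are among the n vertices e_i.  This
-- gives φ ≤ 5 or φ ≤ min(n, 2t + 3).
--
-- Conversely let 5 ≤ k ≤ min(n, 2t + 3).  If e_i has colour i and the i-th copy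
-- together with u_i has the colours i + F modulo k, then properness needs
-- F ⊆ {1, … , k − 2}, and e_i is a b-vertex as soon as F ∪ (F + 1) is
-- {1, … , k − 1}; F = {1, 3, 5, …} ∪ {k − 2} has this property and at most t + 1
-- elements.  The indices i ≥ k repeat the colours of index 0.
-- For n = 3 and n = 4 the e_i are b-vertices of the first n colours, and the
-- missing colours get a b-vertex inside a copy.

module Submission where

open import Defs
open import Data.Fin using (Fin; zero; suc; toℕ; fromℕ; fromℕ<; inject₁; #_)
open import Data.Fin.Properties as Fin
  using (toℕ-injective; toℕ-fromℕ; toℕ-fromℕ<; toℕ-inject₁; toℕ<n;
         fromℕ<-injective; fromℕ<-cong; injective⇒≤; all?; any?)
open import Data.Irrelevant using ([_])
open import Data.List as List using (List; []; _∷_; _++_; length; map; allFin)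
open import Data.List.Membership.Propositional using (_∈_)
open import Data.List.Membership.Propositional.Properties
  using (∈-map⁺; ∈-++⁺ˡ; ∈-++⁺ʳ; ∈-allFin)
open import Data.List.Properties using (length-map; length-++; length-tabulate)
open import Data.List.Relation.Unary.Any using (here; there; index)
open import Data.List.Relation.Unary.Any.Properties using (lookup-index)
open import Data.Nat
  using (ℕ; zero; suc; pred; _+_; _*_; _∸_; _⊓_; _%_; _≤_; _<_; _≤?_; _<?_;
         z≤n; s≤s; NonZero; >-nonZero)
open import Data.Nat.DivMod
open import Data.Nat.Properties
open import Data.Nat.Tactic.RingSolver using (solve-∀)
open import Data.Product using (_×_; _,_; ∃-syntax; proj₁; proj₂)
open import Data.Refinement using (value; _,_)
open import Data.Sum using (_⊎_; inj₁; inj₂; [_,_]′)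
open import Data.Vec using (Vec; []; _∷_; lookup)
open import Function using (_∘_)
open import Relation.Binary.Definitions using (tri<; tri≈; tri>)
open import Relation.Binary.PropositionalEquality
open import Relation.Nullary using (¬_; Dec; yes; no; contradiction)
open import Relation.Nullary.Decidable
  using (recompute; from-yes; _×-dec_; _⊎-dec_; _→-dec_; ¬?)

-- Cyclic order on Fin n

-- Restates the relation local to `cycle`, so that adjacency there unfolds definitionally to
-- `Next i j ⊎ Next j i`.
Next : ∀ {n} → Fin n → Fin n → Set
Next {n} i j = suc (toℕ i) ≡ toℕ j ⊎ (suc (toℕ i) ≡ n × toℕ j ≡ 0)

next : ∀ {n} → Fin n → Fin n
next {suc n} i with suc (toℕ i) <? suc n
... | yes i+1<n = fromℕ< i+1<n
... | no  _     = zero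

prev : ∀ {n} → Fin n → Fin n
prev {suc n} zero    = fromℕ n
prev {suc n} (suc i) = inject₁ i

Next-next : ∀ {n} (i : Fin n) → Next i (next i)
Next-next {suc n} i with suc (toℕ i) <? suc n
... | yes i+1<n = inj₁ (sym (toℕ-fromℕ< i+1<n))
... | no  i+1≮n = inj₂ (≤-antisym (toℕ<n i) (≮⇒≥ i+1≮n) , refl)

Next-prev : ∀ {n} (i : Fin n) → Next (prev i) i
Next-prev {suc n} zero    = inj₂ (cong suc (toℕ-fromℕ n) , refl)
Next-prev {suc n} (suc i) = inj₁ (cong suc (toℕ-inject₁ i))

Next-functional : ∀ {n} {i j k : Fin n} → Next i j → Next i k → j ≡ k
Next-functional (inj₁ p) (inj₁ q) = toℕ-injective (trans (sym p) q)
Next-functional {j = j} (inj₁ p) (inj₂ (q , _)) =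
  contradiction (trans (sym p) q) (<⇒≢ (toℕ<n j))
Next-functional {k = k} (inj₂ (p , _)) (inj₁ q) =
  contradiction (trans (sym q) p) (<⇒≢ (toℕ<n k))
Next-functional (inj₂ (_ , p)) (inj₂ (_ , q)) = toℕ-injective (trans p (sym q))

Next-injective : ∀ {n} {i j k : Fin n} → Next i k → Next j k → i ≡ j
Next-injective (inj₁ p) (inj₁ q) =
  toℕ-injective (suc-injective (trans p (sym q)))
Next-injective (inj₁ p) (inj₂ (_ , q)) = contradiction (trans p q) λ ()
Next-injective (inj₂ (_ , p)) (inj₁ q) = contradiction (trans q p) λ ()
Next-injective (inj₂ (p , _)) (inj₂ (q , _)) =
  toℕ-injective (suc-injective (trans p (sym q)))

-- Two steps that return to their start force `2 + i = i` without a wrap, `n = 2` with one wrap and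
-- `n = 1` with two.
Next-asym : ∀ {n} → 2 < n → {i j : Fin n} → Next i j → ¬ Next j i
Next-asym n>2 {i} (inj₁ p) (inj₁ q) =
  m≢1+n+m (toℕ i) {1} (sym (trans (cong suc p) q))
Next-asym n>2 (inj₁ p) (inj₂ (q , r)) =
  <⇒≢ n>2 (trans (cong (2 +_) (sym r)) (trans (cong suc p) q))
Next-asym n>2 (inj₂ (p , q)) (inj₁ r) =
  <⇒≢ n>2 (trans (cong (2 +_) (sym q)) (trans (cong suc r) p))
Next-asym n>2 (inj₂ (p , q)) (inj₂ (r , _)) =
  <⇒≢ (<-trans (n<1+n 1) n>2) (trans (cong suc (sym q)) r)

-- Vertices and edges of the corona of two cycles

module CycleEdge {n} (n>2 : 2 < n) where
  open Graph (cycle n n>2) public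

  -- The adjacency proof stored in an `Edge` is irrelevant; decidability of `_~_` recovers one that
  -- can be matched on.
  edge-orient : (e : Edge) →
    Next (proj₁ (value e)) (proj₂ (value e)) ⊎ Next (proj₂ (value e)) (proj₁ (value e))
  edge-orient ((u , v) , [ p ]) = recompute (u ~? v) (proj₂ p)

  -- Edges are stored in index order, so the one joining the last vertex to 0 is stored against the
  -- cyclic order. The label is always the cyclic tail.
  label : Edge → Fin n
  label e with edge-orient e
  ... | inj₁ _ = proj₁ (value e)
  ... | inj₂ _ = proj₂ (value e)

  ∈ₑ⇒label : ∀ {u} e → u ∈ₑ e → u ≡ label e ⊎ u ≡ next (label e)
  ∈ₑ⇒label e u∈e with edge-orient e | u∈e
  ... | inj₁ a | inj₁ p = inj₁ p
  ... | inj₁ a | inj₂ p = inj₂ (trans p (Next-functional a (Next-next _)))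
  ... | inj₂ a | inj₁ p = inj₂ (trans p (Next-functional a (Next-next _)))
  ... | inj₂ a | inj₂ p = inj₁ p

  i≢next : ∀ i → i ≢ next i
  i≢next i eq = Next-asym n>2 p p
    where
    p : Next i i
    p = subst (Next i) (sym eq) (Next-next i)

  edge : Fin n → Edge
  edge i with Fin.<-cmp i (next i)
  ... | tri< i<j _ _ = (i , next i) , [ i<j , inj₁ (Next-next i) ]
  ... | tri≈ _ i≡j _ = contradiction i≡j (i≢next i)
  ... | tri> _ _ j<i = (next i , i) , [ j<i , inj₂ (Next-next i) ]

  ∈ₑ-edge : ∀ i → i ∈ₑ edge i
  ∈ₑ-edge i with Fin.<-cmp i (next i)
  ... | tri< _ _ _ = inj₁ refl
  ... | tri≈ _ i≡j _ = contradiction i≡j (i≢next i)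
  ... | tri> _ _ _ = inj₂ refl

  next-∈ₑ-edge : ∀ i → next i ∈ₑ edge i
  next-∈ₑ-edge i with Fin.<-cmp i (next i)
  ... | tri< _ _ _ = inj₂ refl
  ... | tri≈ _ i≡j _ = contradiction i≡j (i≢next i)
  ... | tri> _ _ _ = inj₁ refl

  label-edge : ∀ i → label (edge i) ≡ i
  label-edge i with ∈ₑ⇒label (edge i) (∈ₑ-edge i)
                  | ∈ₑ⇒label (edge i) (next-∈ₑ-edge i)
  ... | inj₁ p | _      = sym p
  -- Here `i` and `next i` would each succeed the other.
  ... | inj₂ p | inj₁ q =
    contradiction (subst₂ Next (sym q) (sym p) (Next-next (label (edge i))))
      (Next-asym n>2 (Next-next i))
  ... | inj₂ p | inj₂ q =
    sym (Next-injective (Next-next i) (subst (Next _) (sym q) (Next-next _)))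

  -- The stored index order selects the branch of `Fin.<-cmp` that `edge` takes; the endpoints then
  -- agree, and irrelevance of the proofs leaves `refl`.
  edge-label : ∀ e → edge (label e) ≡ e
  edge-label e@((u , v) , [ p ]) with edge-orient e | recompute (toℕ u <? toℕ v) (proj₁ p)
  ... | inj₁ a | u<v with refl ← Next-functional a (Next-next u)
                     with Fin.<-cmp u (next u)
  ...   | tri< _ _ _     = refl
  ...   | tri≈ ¬u<v _ _  = contradiction u<v ¬u<v
  ...   | tri> ¬u<v _ _  = contradiction u<v ¬u<v
  edge-label e@((u , v) , [ p ]) | inj₂ a | u<v
                     with refl ← Next-functional a (Next-next v)
                     with Fin.<-cmp v (next v)
  ...   | tri< _ _ ¬u<v  = contradiction u<v ¬u<v
  ...   | tri≈ _ _ ¬u<v  = contradiction u<v ¬u<v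
  ...   | tri> _ _ _     = refl

-- The upper bound

module _ {V : Set} {l} (c : V → Fin l) where

  -- Pigeonhole: each colour goes to the position in `xs` of a vertex bearing it. The vertex at a
  -- position determines its colour, so this map is injective.
  colours-≤-length : (xs : List V) → (∀ j → ∃[ w ] (w ∈ xs × c w ≡ j)) → l ≤ length xs
  colours-≤-length xs p = injective⇒≤ {f = λ j → index (proj₁ (proj₂ (p j)))} λ {i} {j} eq →
    let (v , v∈ , cv) = p i ; (w , w∈ , cw) = p j in
    trans (sym cv) (trans (cong c (trans (lookup-index v∈)
      (trans (cong (List.lookup xs) eq) (sym (lookup-index w∈))))) cw)

-- A b-vertex together with its neighbours carries every colour. `xs` need only contain the
-- neighbours, so repetitions in it do no harm.
bVertex-degree : ∀ G {l} (c : Graph.Vertex G → Fin l) {v} xs → IsBVertex G c v →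
                 (∀ w → Graph._~_ G v w → w ∈ xs) → l ≤ suc (length xs)
bVertex-degree G c {v} xs b nbrs = colours-≤-length c (v ∷ xs) λ j →
  case-≟ j (j Fin.≟ c v)
  where
  case-≟ : ∀ j → Dec (j ≡ c v) → ∃[ w ] (w ∈ v ∷ xs × c w ≡ j)
  case-≟ j (yes eq) = v , here refl , sym eq
  case-≟ j (no ≢)   = let (w , v~w , cw) = b j ≢ in w , there (nbrs w v~w) , cw

module UpperBound {n t} (n>2 : 2 < n) (t>2 : 2 < t) where
  open CycleEdge n>2
  G⊡H = cycle n n>2 ⊡ cycle t t>2
  open Graph G⊡H using () renaming (Vertex to V; _~_ to _~ᵥ_)

  vertexNbrs : Fin n → List V
  vertexNbrs u = map (inj₁ ∘ inj₂ ∘ edge) (u ∷ prev u ∷ [])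

  ∈-vertexNbrs : ∀ {u} e → u ∈ₑ e → inj₁ (inj₂ e) ∈ vertexNbrs u
  ∈-vertexNbrs e u∈e = subst (λ f → inj₁ (inj₂ f) ∈ vertexNbrs _) (edge-label e)
    (∈-map⁺ (inj₁ ∘ inj₂ ∘ edge) (lemma (∈ₑ⇒label e u∈e)))
    where
    lemma : ∀ {u i} → u ≡ i ⊎ u ≡ next i → i ∈ u ∷ prev u ∷ []
    lemma (inj₁ refl)        = here refl
    lemma {i = i} (inj₂ refl) =
      there (here (Next-injective (Next-next i) (Next-prev (next i))))

  copyNbrs : Fin n → Fin t → List V
  copyNbrs u h = vertexNbrs u ++ map (λ k → inj₂ (u , k)) (next h ∷ prev h ∷ [])

  petals : Fin n → List V
  petals u = inj₁ (inj₁ u) ∷ map (λ h → inj₂ (u , h)) (allFin t)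

  edgeNbrs : Edge → List V
  edgeNbrs e = petals (label e) ++ petals (next (label e))

  ∈-edgeNbrs : ∀ {e u v} → v ∈ petals u → u ∈ₑ e → v ∈ edgeNbrs e
  ∈-edgeNbrs {e} v∈ u∈e with ∈ₑ⇒label e u∈e
  ... | inj₁ refl = ∈-++⁺ˡ v∈
  ... | inj₂ refl = ∈-++⁺ʳ (petals (label e)) v∈

  length-edgeNbrs : ∀ e → length (edgeNbrs e) ≡ suc t + suc t
  length-edgeNbrs e =
    trans (length-++ (petals (label e))) (cong₂ _+_ (length-petals _) (length-petals _))
    where
    length-petals : ∀ u → length (petals u) ≡ suc t
    length-petals u =
      cong suc (trans (length-map _ (allFin t)) (length-tabulate {n = t} (λ h → h)))

  bVertex-is-edge : ∀ {l} → 5 < l → (c : V → Fin l) → ∀ v → IsBVertex G⊡H c v →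
                    ∃[ e ] v ≡ inj₁ (inj₂ e)
  bVertex-is-edge 5<l c (inj₁ (inj₂ e)) b = e , refl
  bVertex-is-edge {l} 5<l c (inj₁ (inj₁ u)) b = contradiction
    -- Two neighbours allow three colours, so the bound reads `6 ≤ 3`; for a copy vertex below it
    -- reads `6 ≤ 5`.
    (≤-trans 5<l (bVertex-degree G⊡H c (vertexNbrs u) b nbrs)) (<⇒≱ (m≤m+n 4 2))
    where
    nbrs : ∀ w → inj₁ (inj₁ u) ~ᵥ w → w ∈ vertexNbrs u
    nbrs (inj₁ (inj₂ e)) u∈e = ∈-vertexNbrs e u∈e
    nbrs (inj₂ _) ()
  bVertex-is-edge {l} 5<l c (inj₂ (u , h)) b = contradiction
    (≤-trans 5<l (bVertex-degree G⊡H c (copyNbrs u h) b nbrs)) (<⇒≱ ≤-refl)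
    where
    nbrs : ∀ w → inj₂ (u , h) ~ᵥ w → w ∈ copyNbrs u h
    nbrs (inj₁ (inj₂ e)) u∈e = ∈-++⁺ˡ (∈-vertexNbrs e u∈e)
    nbrs (inj₂ (_ , k)) (refl , inj₁ p) with refl ← Next-functional p (Next-next h) =
      ∈-++⁺ʳ (vertexNbrs u) (here refl)
    nbrs (inj₂ (_ , k)) (refl , inj₂ p) with refl ← Next-injective p (Next-prev h) =
      ∈-++⁺ʳ (vertexNbrs u) (there (here refl))

  bColoring-≤ : ∀ {l} → HasBColoring G⊡H l → l ≤ 5 ⊎ (l ≤ n × l ≤ 2 * t + 3)
  bColoring-≤ {l} (c , _ , b) with l ≤? 5
  ... | yes l≤5 = inj₁ l≤5
  ... | no  l≰5 = inj₂ (l≤n , l≤2t+3)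
    where
    bEdge : ∀ j → ∃[ e ] (c (inj₁ (inj₂ e)) ≡ j × IsBVertex G⊡H c (inj₁ (inj₂ e)))
    bEdge j with b j
    ... | v , cv , bv with bVertex-is-edge (≰⇒> l≰5) c v bv
    ...   | e , refl = e , cv , bv

    l≤n : l ≤ n
    -- Every colour occurs on some e_i, and `edge` enumerates these, so the pigeonhole runs over n
    -- vertices only.
    l≤n = subst (l ≤_)
      (trans (length-map edge (allFin n)) (length-tabulate {n = n} (λ i → i)))
      (colours-≤-length (c ∘ inj₁ ∘ inj₂) (map edge (allFin n)) λ j →
        let (e , ce , _) = bEdge j in
        e , subst (_∈ _) (edge-label e) (∈-map⁺ edge (∈-allFin (label e))) , ce)

    l≤2t+3 : l ≤ 2 * t + 3
    l≤2t+3 =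
      -- Any colour serves; `5 < l` supplies colour 5.
      let (e , _ , be) = bEdge (fromℕ< (≰⇒> l≰5)) in
      subst (l ≤_) (trans (cong suc (length-edgeNbrs e)) (arith t))
        (bVertex-degree G⊡H c (edgeNbrs e) be (nbrs e))
      where
      arith : ∀ t → suc (suc t + suc t) ≡ 2 * t + 3
      arith = solve-∀

      nbrs : ∀ e w → inj₁ (inj₂ e) ~ᵥ w → w ∈ edgeNbrs e
      nbrs e (inj₁ (inj₁ u)) u∈e = ∈-edgeNbrs (here refl) u∈e
      nbrs e (inj₂ (u , h)) u∈e = ∈-edgeNbrs (there (∈-map⁺ _ (∈-allFin h))) u∈e

-- Colourings

pad : ℕ → ℕ
pad 0             = 2
pad 1             = 1
pad (suc (suc x)) = pad x

1≤pad : ∀ x → 1 ≤ pad x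
1≤pad 0             = s≤s z≤n
1≤pad 1             = s≤s z≤n
1≤pad (suc (suc x)) = 1≤pad x

pad≤2 : ∀ x → pad x ≤ 2
pad≤2 0             = ≤-refl
pad≤2 1             = s≤s z≤n
pad≤2 (suc (suc x)) = pad≤2 x

pad-suc : ∀ x → pad (suc x) ≢ pad x
pad-suc 0             ()
pad-suc 1             ()
pad-suc (suc (suc x)) = pad-suc x

halve : ∀ e → ∃[ h ] (e ≡ h + h ⊎ e ≡ suc (h + h))
halve zero = 0 , inj₁ refl
halve (suc e) with halve e
... | h , inj₁ refl = h , inj₂ refl
... | h , inj₂ refl = suc h , inj₁ (cong suc (sym (+-suc h h)))

halve-≤ : ∀ {h t} → h + h ≤ suc (t + t) → h ≤ t
halve-≤ {h} {t} p with h ≤? t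
... | yes h≤t = h≤t
... | no  h≰t = contradiction
  (≤-trans (+-mono-≤ (≰⇒> h≰t) (≰⇒> h≰t)) p)
  (<⇒≱ (s≤s (≤-reflexive (sym (+-suc t t)))))

-- The sequence 1, 3, 5, … , capped at κ, and then alternately 1 and 2.  The padding
-- is counted back from position t − 1, so that it ends in 2 against the initial 1.
palette : (κ t h : ℕ) → ℕ
palette κ t h with h + h ≤? κ
... | yes _ = suc (h + h) ⊓ κ
... | no  _ = pad (t ∸ suc h)

module Pattern {κ t} (3≤κ : 3 ≤ κ) (2<t : 2 < t) where
  f : ℕ → ℕ
  f = palette κ t

  1≤f : ∀ h → 1 ≤ f h
  1≤f h with h + h ≤? κ
  ... | yes _ = ⊓-glb (s≤s z≤n) (≤-trans (s≤s z≤n) 3≤κ)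
  ... | no  _ = 1≤pad (t ∸ suc h)

  f≤κ : ∀ h → f h ≤ κ
  f≤κ h with h + h ≤? κ
  ... | yes _ = m⊓n≤n (suc (h + h)) κ
  ... | no  _ = ≤-trans (pad≤2 (t ∸ suc h)) (≤-trans (n≤1+n 2) 3≤κ)

  f-zero : f 0 ≡ 1
  f-zero = m≤n⇒m⊓n≡m (≤-trans (s≤s z≤n) 3≤κ)

  private
    3≤odd : ∀ h → 3 ≤ suc (suc h + suc h)
    3≤odd h = s≤s (s≤s (≤-trans (s≤s z≤n) (m≤n+m (suc h) h)))

  t∸t : t ∸ suc (pred t) ≡ 0
  t∸t = trans (cong (t ∸_) (suc-pred t {{>-nonZero (<-trans (s≤s z≤n) 2<t)}})) (n∸n≡0 t)

  -- Closes the cycle against the initial 1. If the odd sequence reaches the last position, its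
  -- value there is at least 3 because `2 < t`; otherwise the padding ends in `pad 0`, which is 2.
  f-last : f (pred t) ≢ 1
  f-last with pred t + pred t ≤? κ
  ... | yes _ = λ eq → <⇒≢ (≤-trans (n≤1+n 2) (⊓-glb 3≤ 3≤κ)) (sym eq)
    where
    3≤ : 3 ≤ suc (pred t + pred t)
    3≤ = s≤s (≤-trans (pred-mono-≤ 2<t) (m≤m+n (pred t) (pred t)))
  ... | no  _ = λ eq → contradiction
    (trans (sym (cong pad t∸t)) eq) λ ()

  -- The capped odd sequence strictly increases and the padding alternates. At the junction the last
  -- odd value is at least 3, since position 1 is still unpadded, while the padding is at most 2.
  f-suc : ∀ h → suc h < t → f (suc h) ≢ f h
  f-suc h h+1<t with h + h ≤? κ | suc h + suc h ≤? κ
  ... | yes _ | yes q = λ eq → <⇒≢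
    (≤-<-trans (m⊓n≤m (suc (h + h)) κ)
      (⊓-glb (s≤s (s≤s (+-monoʳ-≤ h (n≤1+n h))))
             (≤-trans (≤-reflexive (cong suc (sym (+-suc h h)))) q)))
    (sym eq)
  ... | no p  | yes q = contradiction (≤-trans (+-mono-≤ (n≤1+n h) (n≤1+n h)) q) p
  ... | no _  | no _  = λ eq → pad-suc (t ∸ suc (suc h))
    (trans (cong pad (sym (+-∸-assoc 1 h+1<t))) (sym eq))
  f-suc zero h+1<t | yes _ | no q = contradiction (≤-trans (n≤1+n 2) 3≤κ) q
  f-suc (suc h) h+1<t | yes _ | no _ = λ eq → <⇒≢
    (≤-<-trans (pad≤2 (t ∸ suc (suc (suc h)))) (⊓-glb (3≤odd h) 3≤κ)) eq

  f-proper : ∀ {h k : Fin t} → Next h k → f (toℕ h) ≢ f (toℕ k)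
  f-proper {h} {k} (inj₁ p) eq = f-suc (toℕ h) (subst (_< t) (sym p) (toℕ<n k))
    (trans (cong f p) (sym eq))
  f-proper {h} {k} (inj₂ (p , q)) eq = f-last
    (trans (cong f (cong pred (sym p))) (trans eq (trans (cong f q) f-zero)))

  -- Write `d = suc e` and let `h` be half of `e`, rounded down. For odd `e`, `f h = e`; for even
  -- `e < κ`, `f h = suc e`; for even `e = κ` the cap gives `f h = κ = e`.
  f-cover : κ ≤ suc (t + t) → ∀ d → 1 ≤ d → d ≤ suc κ →
            ∃[ h ] (h ≤ t × (f h ≡ d ⊎ suc (f h) ≡ d))
  f-cover κ≤2t+1 (suc e) _ (s≤s e≤κ) with halve e
  ... | h , eq = h , halve-≤ (≤-trans 2h≤κ κ≤2t+1) , f-value eq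
    where
    2h≤e : e ≡ h + h ⊎ e ≡ suc (h + h) → h + h ≤ e
    2h≤e (inj₁ refl) = ≤-refl
    2h≤e (inj₂ refl) = n≤1+n _
    2h≤κ : h + h ≤ κ
    2h≤κ = ≤-trans (2h≤e eq) e≤κ
    f-value : e ≡ h + h ⊎ e ≡ suc (h + h) → f h ≡ suc e ⊎ suc (f h) ≡ suc e
    f-value eq with h + h ≤? κ
    f-value eq          | no p  = contradiction 2h≤κ p
    f-value (inj₂ refl) | yes _ = inj₂ (cong suc (m≤n⇒m⊓n≡m e≤κ))
    f-value (inj₁ refl) | yes _ with m≤n⇒m<n∨m≡n e≤κ
    ... | inj₁ e<κ  = inj₁ (m≤n⇒m⊓n≡m e<κ)
    ... | inj₂ refl = inj₂ (cong suc (m≥n⇒m⊓n≡n (n≤1+n _)))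

-- `σ i v` is the actual colour of the abstract value `v` in row `i`: 0 stands for e_i, and 1 to `κ`
-- for the palette of the i-th copy and u_i. As e_i meets the palettes of `i` and `next i`,
-- properness at e_i needs injectivity of row `i` for the first and `σ-next` for the second.
module Construction {n t k κ} (n>2 : 2 < n) (t>2 : 2 < t) (3≤κ : 3 ≤ κ)
  (σ : Fin n → ℕ → Fin k)
  (σ-injective : ∀ i {v w} → v ≤ κ → w ≤ κ → σ i v ≡ σ i w → v ≡ w)
  (σ-next : ∀ i {v} → 1 ≤ v → v ≤ κ → σ i 0 ≢ σ (next i) v) where

  open Pattern {κ} {t} 3≤κ t>2 public
  open CycleEdge n>2 public
  G⊡H = cycle n n>2 ⊡ cycle t t>2
  open Graph G⊡H using () renaming (Vertex to V; _~_ to _~ᵥ_)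

  -- u_i takes position t of the palette, after the positions 0, … , t − 1 of
  -- the i-th copy of C_t.
  colour : V → Fin k
  colour (inj₁ (inj₁ u)) = σ u (f t)
  colour (inj₁ (inj₂ e)) = σ (label e) 0
  colour (inj₂ (u , h))  = σ u (f (toℕ h))

  σ-edge : ∀ e {u} h → u ∈ₑ e → σ (label e) 0 ≢ σ u (f h)
  σ-edge e h u∈e with ∈ₑ⇒label e u∈e
  ... | inj₁ refl = λ eq → <⇒≢ (1≤f h) (σ-injective _ z≤n (f≤κ h) eq)
  ... | inj₂ refl = σ-next (label e) (1≤f h) (f≤κ h)

  proper : ∀ v w → v ~ᵥ w → colour v ≢ colour w
  proper (inj₁ (inj₁ u)) (inj₁ (inj₂ e)) u∈e = ≢-sym (σ-edge e t u∈e)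
  proper (inj₁ (inj₁ u)) (inj₂ _) ()
  proper (inj₁ (inj₂ e)) (inj₁ (inj₁ u)) u∈e = σ-edge e t u∈e
  proper (inj₁ (inj₂ e)) (inj₂ (u , h))  u∈e = σ-edge e (toℕ h) u∈e
  proper (inj₂ (u , h))  (inj₁ (inj₂ e)) u∈e = ≢-sym (σ-edge e (toℕ h) u∈e)
  proper (inj₂ (u , h))  (inj₂ (_ , k))  (refl , inj₁ p) =
    f-proper p ∘ σ-injective u (f≤κ (toℕ h)) (f≤κ (toℕ k))
  proper (inj₂ (u , h))  (inj₂ (_ , k))  (refl , inj₂ p) =
    ≢-sym (f-proper p) ∘ σ-injective u (f≤κ (toℕ h)) (f≤κ (toℕ k))

  edgeVertex : Fin n → V
  edgeVertex = inj₁ ∘ inj₂ ∘ edge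

  colour-edgeVertex : ∀ i → colour (edgeVertex i) ≡ σ i 0
  colour-edgeVertex i = cong (λ u → σ u 0) (label-edge i)

  petal : ∀ i {u} h → h ≤ t → u ∈ₑ edge i →
          ∃[ w ] (edgeVertex i ~ᵥ w × colour w ≡ σ u (f h))
  petal i {u} h h≤t u∈e with m≤n⇒m<n∨m≡n h≤t
  ... | inj₁ h<t  = inj₂ (u , fromℕ< h<t) , u∈e , cong (σ u ∘ f) (toℕ-fromℕ< h<t)
  ... | inj₂ refl = inj₁ (inj₁ u) , u∈e , refl

  Covers : Fin n → Set
  Covers i = ∀ j → j ≢ σ i 0 → ∃[ h ] (h ≤ t × (σ i (f h) ≡ j ⊎ σ (next i) (f h) ≡ j))

  edgeVertex-bVertex : ∀ i → Covers i → IsBVertex G⊡H colour (edgeVertex i)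
  edgeVertex-bVertex i covers j j≢
    with covers j (λ eq → j≢ (trans eq (sym (colour-edgeVertex i))))
  ... | h , h≤t , inj₁ eq =
    let (w , i~w , cw) = petal i h h≤t (∈ₑ-edge i) in w , i~w , trans cw eq
  ... | h , h≤t , inj₂ eq =
    let (w , i~w , cw) = petal i h h≤t (next-∈ₑ-edge i) in w , i~w , trans cw eq

-- Explicit tables for n = 3 and n = 4: row i lists the colour of e_i and then the
-- colours that stand for 1, 2, 3 in the palette of the i-th copy and u_i.

module Table {n t} (n>2 : 2 < n) (t>2 : 2 < t) (T : Fin n → Fin 4 → Fin 5) where

  -- The condition for position 0 of the i-th copy to be a b-vertex: its four neighbours are the two
  -- subdivision vertices at u_i, position 1 with value 3 and the last position with value 2.
  Centre : Fin n → Set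
  Centre i = ∀ j → j ≢ T i (# 1) →
    j ≡ T (prev i) (# 0) ⊎ j ≡ T i (# 0) ⊎ j ≡ T i (# 3) ⊎ j ≡ T i (# 2)

  -- The first two clauses feed `Construction`, the third makes every e_i a b-vertex, and the last
  -- provides a b-vertex of each colour. Only finite quantifiers occur and `t` does not, so
  -- evaluation settles it for all `t` at once.
  Valid : Set
  Valid = (∀ i a b → T i a ≡ T i b → a ≡ b)
        × (∀ i a → T i (# 0) ≢ T (next i) (suc a))
        × (∀ i j → j ≢ T i (# 0) → ∃[ a ] (T i (suc a) ≡ j ⊎ T (next i) (suc a) ≡ j))
        × (∀ j → ∃[ i ] (T i (# 0) ≡ j ⊎ (T i (# 1) ≡ j × Centre i)))

  valid? : Dec Valid
  valid? = all? (λ i → all? λ a → all? λ b → (T i a Fin.≟ T i b) →-dec (a Fin.≟ b))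
    ×-dec all? (λ i → all? λ a → ¬? (T i (# 0) Fin.≟ T (next i) (suc a)))
    ×-dec all? (λ i → all? λ j → ¬? (j Fin.≟ T i (# 0)) →-dec
            any? λ a → (T i (suc a) Fin.≟ j) ⊎-dec (T (next i) (suc a) Fin.≟ j))
    ×-dec all? (λ j → any? λ i → (T i (# 0) Fin.≟ j) ⊎-dec ((T i (# 1) Fin.≟ j) ×-dec
            all? λ j → ¬? (j Fin.≟ T i (# 1)) →-dec
              ((j Fin.≟ T (prev i) (# 0)) ⊎-dec (j Fin.≟ T i (# 0)) ⊎-dec
               (j Fin.≟ T i (# 3)) ⊎-dec (j Fin.≟ T i (# 2)))))

  module _ (valid : Valid) where
    T-injective = proj₁ valid
    T-next      = proj₁ (proj₂ valid)
    T-covers    = proj₁ (proj₂ (proj₂ valid))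
    T-bVertex   = proj₂ (proj₂ (proj₂ valid))

    -- Reduction modulo 4 only makes `σ` total; the palette values stay at most 3.
    σ : Fin n → ℕ → Fin 5
    σ i v = T i (v mod 4)

    σ-injective : ∀ i {v w} → v ≤ 3 → w ≤ 3 → σ i v ≡ σ i w → v ≡ w
    σ-injective i {v} {w} v≤3 w≤3 eq = trans (sym (m≤n⇒m%n≡m v≤3))
      (trans (fromℕ<-injective _ _ _ _ (T-injective i (v mod 4) (w mod 4) eq))
             (m≤n⇒m%n≡m w≤3))

    σ-next : ∀ i {v} → 1 ≤ v → v ≤ 3 → σ i 0 ≢ σ (next i) v
    σ-next i {1} _ _ = T-next i (# 0)
    σ-next i {2} _ _ = T-next i (# 1)
    σ-next i {3} _ _ = T-next i (# 2)
    σ-next i {suc (suc (suc (suc _)))} _ (s≤s (s≤s (s≤s ())))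

    open Construction n>2 t>2 (≤-refl {3}) σ σ-injective σ-next

    -- With cap 3 the odd sequence occupies positions 0 and 1 only, so the last position is padding.
    f-last≡2 : f (pred t) ≡ 2
    f-last≡2 with pred t + pred t ≤? 3
    ... | yes p = contradiction
      (≤-trans (+-mono-≤ (pred-mono-≤ t>2) (pred-mono-≤ t>2)) p) (<⇒≱ ≤-refl)
    ... | no  _ = cong pad t∸t

    position : ∀ a → ∃[ h ] (h ≤ t × f h ≡ suc (toℕ {3} a))
    position zero             = 0 , z≤n , refl
    position (suc zero)       = pred t , pred[n]≤n , f-last≡2
    position (suc (suc zero)) = 1 , ≤-trans (s≤s z≤n) t>2 , refl

    σ-suc : ∀ i a → σ i (suc (toℕ a)) ≡ T i (suc a)
    σ-suc i zero             = refl
    σ-suc i (suc zero)       = refl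
    σ-suc i (suc (suc zero)) = refl

    covers : ∀ i → Covers i
    covers i j j≢ with T-covers i j j≢
    ... | a , inj₁ eq = let (h , h≤t , fh) = position a in
      h , h≤t , inj₁ (trans (cong (σ i) fh) (trans (σ-suc i a) eq))
    ... | a , inj₂ eq = let (h , h≤t , fh) = position a in
      h , h≤t , inj₂ (trans (cong (σ (next i)) fh) (trans (σ-suc (next i) a) eq))

    1<t : 1 < t
    1<t = <-trans (n<1+n 1) t>2

    first second : Fin t
    first  = fromℕ< (<-trans (s≤s z≤n) 1<t)
    second = fromℕ< 1<t

    toℕ-first : toℕ first ≡ 0
    toℕ-first = toℕ-fromℕ< _

    toℕ-second : toℕ second ≡ 1
    toℕ-second = toℕ-fromℕ< _

    f-prev-first : f (toℕ (prev first)) ≡ 2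
    f-prev-first with Next-prev first
    ... | inj₁ p       = contradiction (trans p toℕ-first) λ ()
    ... | inj₂ (p , _) = trans (cong (f ∘ pred) p) f-last≡2

    colour-first : ∀ i → colour (inj₂ (i , first)) ≡ T i (# 1)
    colour-first i = cong (σ i ∘ f) toℕ-first

    first-bVertex : ∀ i → Centre i → IsBVertex G⊡H colour (inj₂ (i , first))
    first-bVertex i centre j j≢ with centre j (λ eq → j≢ (trans eq (sym (colour-first i))))
    ... | inj₁ eq =
      edgeVertex (prev i) ,
      subst (_∈ₑ edge (prev i)) (Next-functional (Next-next (prev i)) (Next-prev i))
            (next-∈ₑ-edge (prev i)) ,
      trans (colour-edgeVertex (prev i)) (sym eq)
    ... | inj₂ (inj₁ eq) = edgeVertex i , ∈ₑ-edge i , trans (colour-edgeVertex i) (sym eq)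
    ... | inj₂ (inj₂ (inj₁ eq)) =
      inj₂ (i , second) ,
      (refl , inj₁ (inj₁ (trans (cong suc toℕ-first) (sym toℕ-second)))) ,
      trans (cong (σ i ∘ f) toℕ-second) (sym eq)
    ... | inj₂ (inj₂ (inj₂ eq)) =
      inj₂ (i , prev first) , (refl , inj₂ (Next-prev first)) ,
      trans (cong (σ i) f-prev-first) (sym eq)

    bColoring : HasBColoring (cycle n n>2 ⊡ cycle t t>2) 5
    bColoring = colour , (λ {v} {w} → proper v w) , λ j → bVertex j (T-bVertex j)
      where
      bVertex : ∀ j → ∃[ i ] (T i (# 0) ≡ j ⊎ (T i (# 1) ≡ j × Centre i)) →
                ∃[ v ] (colour v ≡ j × IsBVertex G⊡H colour v)
      bVertex j (i , inj₁ eq) =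
        edgeVertex i , trans (colour-edgeVertex i) eq , edgeVertex-bVertex i (covers i)
      bVertex j (i , inj₂ (eq , centre)) =
        inj₂ (i , first) , trans (colour-first i) eq , first-bVertex i centre

module _ {t} (t>2 : 2 < t) where
  private
    lookup₂ : ∀ {n} → Vec (Vec (Fin 5) 4) n → Fin n → Fin 4 → Fin 5
    lookup₂ rows i = lookup (lookup rows i)

  bColoring-3 : (n>2 : 2 < 3) → HasBColoring (cycle 3 n>2 ⊡ cycle t t>2) 5
  bColoring-3 n>2 = Table.bColoring n>2 t>2 T (from-yes (Table.valid? n>2 t>2 T))
    where
    -- Colours 0, 1, 2 have their b-vertices at the e_i; `Centre` holds in rows 0 and 1, giving
    -- b-vertices of colours 3 and 4.
    T = lookup₂ ( (# 0 ∷ # 3 ∷ # 1 ∷ # 4 ∷ [])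
                ∷ (# 1 ∷ # 4 ∷ # 2 ∷ # 3 ∷ [])
                ∷ (# 2 ∷ # 0 ∷ # 3 ∷ # 4 ∷ []) ∷ [])

  bColoring-4 : (n>2 : 2 < 4) → HasBColoring (cycle 4 n>2 ⊡ cycle t t>2) 5
  bColoring-4 n>2 = Table.bColoring n>2 t>2 T (from-yes (Table.valid? n>2 t>2 T))
    where
    -- Only colour 4 is missing from the e_i; `Centre` in row 0 supplies it.
    T = lookup₂ ( (# 0 ∷ # 4 ∷ # 1 ∷ # 2 ∷ [])
                ∷ (# 1 ∷ # 2 ∷ # 3 ∷ # 4 ∷ [])
                ∷ (# 2 ∷ # 0 ∷ # 3 ∷ # 4 ∷ [])
                ∷ (# 3 ∷ # 0 ∷ # 1 ∷ # 4 ∷ []) ∷ [])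

-- Rotated palettes, for at least five subdivision vertices

shift-injective : ∀ {a k v w} .{{_ : NonZero k}} → a ≤ k → v < k → w < k →
                  (a + v) % k ≡ (a + w) % k → v ≡ w
shift-injective {a} {k} {v} {w} a≤k v<k w<k eq = trans (sym (unshift v v<k))
  (trans (cong (λ x → (k ∸ a + x) % k) eq) (unshift w w<k))
  where
  -- Adding `k ∸ a` modulo `k` undoes the shift by `a`.
  unshift : ∀ x → x < k → (k ∸ a + (a + x) % k) % k ≡ x
  unshift x x<k = begin
    (k ∸ a + (a + x) % k) % k  ≡⟨ +-%ʳ (k ∸ a) (a + x) ⟩
    (k ∸ a + (a + x)) % k      ≡⟨ cong (_% k) (sym (+-assoc (k ∸ a) a x)) ⟩
    (k ∸ a + a + x) % k        ≡⟨ cong (λ y → (y + x) % k) (m∸n+n≡m a≤k) ⟩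
    (k + x) % k                ≡⟨ cong (_% k) (+-comm k x) ⟩
    (x + k) % k                ≡⟨ [m+n]%n≡m%n x k ⟩
    x % k                      ≡⟨ m<n⇒m%n≡m x<k ⟩
    x                          ∎
    where
    open ≡-Reasoning
    +-%ʳ : ∀ a b → (a + b % k) % k ≡ (a + b) % k
    +-%ʳ a b = trans (%-distribˡ-+ a (b % k) k)
      (trans (cong (λ x → (a % k + x) % k) (m%n%n≡m%n b k)) (sym (%-distribˡ-+ a b k)))

shift-surjective : ∀ {a k} .{{_ : NonZero k}} → a ≤ k → ∀ {j} → j < k →
                   ∃[ d ] (d < k × (a + d) % k ≡ j)
shift-surjective {a} {k} a≤k {j} j<k with a ≤? j
... | yes a≤j = j ∸ a , ≤-<-trans (m∸n≤m j a) j<k ,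
  trans (cong (_% k) (m+[n∸m]≡n a≤j)) (m<n⇒m%n≡m j<k)
... | no  a≰j =
  k ∸ a + j ,
  <-≤-trans (+-monoʳ-< (k ∸ a) (≰⇒> a≰j)) (≤-reflexive (m∸n+n≡m a≤k)) ,
  trans (cong (_% k) (trans (sym (+-assoc a (k ∸ a) j))
                            (trans (cong (_+ j) (m+[n∸m]≡n a≤k)) (+-comm k j))))
    (trans ([m+n]%n≡m%n j k) (m<n⇒m%n≡m j<k))

module Rotation {n t κ} (n>2 : 2 < n) (t>2 : 2 < t) (3≤κ : 3 ≤ κ)
  (κ≤2t+1 : κ ≤ suc (t + t)) (k≤n : 2 + κ ≤ n) where

  -- Relative to the colour of e_i, for `i < k`, row `i` must avoid 0 and also `k - 1`, the shift
  -- that leads to the colour preceding it cyclically. This leaves the `κ` values 1 to `κ`.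
  k = 2 + κ

  ι : Fin n → ℕ
  ι i with toℕ i <? k
  ... | yes _ = toℕ i
  ... | no  _ = 0

  ι-< : ∀ {i} → toℕ i < k → ι i ≡ toℕ i
  ι-< {i} i<k with toℕ i <? k
  ... | yes _   = refl
  ... | no  i≮k = contradiction i<k i≮k

  ι-≥ : ∀ {i} → k ≤ toℕ i → ι i ≡ 0
  ι-≥ {i} k≤i with toℕ i <? k
  ... | yes i<k = contradiction k≤i (<⇒≱ i<k)
  ... | no  _   = refl

  ι≤k : ∀ i → ι i ≤ k
  ι≤k i with toℕ i <? k
  ... | yes i<k = <⇒≤ i<k
  ... | no  _   = z≤n

  σ : Fin n → ℕ → Fin k
  σ i v = (ι i + v) mod k

  toℕ-σ : ∀ i v → toℕ (σ i v) ≡ (ι i + v) % k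
  toℕ-σ i v = toℕ-fromℕ< _

  σ-injective-< : ∀ i {v w} → v < k → w < k → σ i v ≡ σ i w → v ≡ w
  σ-injective-< i v<k w<k eq = shift-injective (ι≤k i) v<k w<k (fromℕ<-injective _ _ _ _ eq)

  κ<k : ∀ {v} → v ≤ κ → v < k
  κ<k v≤κ = s≤s (m≤n⇒m≤1+n v≤κ)

  -- Past the wrap-around, ι (next i) = 0 represents ι i + 1 = k.
  σ-next-< : ∀ {i} v → toℕ i < k → σ (next i) v ≡ σ i (suc v)
  σ-next-< {i} v i<k = fromℕ<-cong _ _
    (trans (lemma (Next-next i)) (cong (λ x → (x + suc v) % k) (sym (ι-< i<k)))) _ _
    where
    wrap : ∀ {a} → suc (toℕ i) ≡ k → a ≡ 0 → (a + v) % k ≡ (toℕ i + suc v) % k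
    wrap p refl = trans (sym ([m+n]%n≡m%n v k)) (cong (_% k)
      (trans (+-comm v k) (trans (cong (_+ v) (sym p)) (sym (+-suc (toℕ i) v)))))

    lemma : Next i (next i) → (ι (next i) + v) % k ≡ (toℕ i + suc v) % k
    lemma (inj₁ p) with m≤n⇒m<n∨m≡n i<k
    ... | inj₁ i+1<k = cong (_% k)
      (trans (cong (_+ v) (trans (ι-< (subst (_< k) p i+1<k)) (sym p))) (sym (+-suc (toℕ i) v)))
    ... | inj₂ i+1≡k = wrap i+1≡k (ι-≥ (≤-reflexive (trans (sym i+1≡k) p)))
    lemma (inj₂ (p , q)) = wrap (≤-antisym i<k (subst (k ≤_) (sym p) k≤n))
      (trans (ι-< (subst (_< k) (sym q) (s≤s z≤n))) q)

  -- The successor of a repeated index is again repeated or is index 0, so both use row 0.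
  σ-next-≥ : ∀ {i} v → k ≤ toℕ i → σ (next i) v ≡ σ i v
  σ-next-≥ {i} v k≤i =
    cong (λ x → (x + v) mod k) (trans (lemma (Next-next i)) (sym (ι-≥ k≤i)))
    where
    lemma : Next i (next i) → ι (next i) ≡ 0
    lemma (inj₁ p)       = ι-≥ (≤-trans k≤i (≤-trans (n≤1+n _) (≤-reflexive p)))
    lemma (inj₂ (_ , q)) = trans (ι-< (subst (_< k) (sym q) (s≤s z≤n))) q

  -- For `i < k` the right side is `σ i (suc v)` with `suc v < k`; otherwise both indices share a
  -- row. Either way injectivity of that row separates the value from 0.
  σ-next : ∀ i {v} → 1 ≤ v → v ≤ κ → σ i 0 ≢ σ (next i) v
  σ-next i {v} 1≤v v≤κ eq with <-≤-connex (toℕ i) k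
  ... | inj₁ i<k = contradiction
    (σ-injective-< i (s≤s z≤n) (s≤s (s≤s v≤κ)) (trans eq (σ-next-< v i<k))) λ ()
  ... | inj₂ k≤i = <⇒≢ 1≤v
    (σ-injective-< i (s≤s z≤n) (κ<k v≤κ) (trans eq (σ-next-≥ v k≤i)))

  open Construction n>2 t>2 3≤κ σ
    (λ i v≤κ w≤κ → σ-injective-< i (κ<k v≤κ) (κ<k w≤κ)) σ-next

  -- A colour other than that of e_i is a shift by some `d` from 1 to `suc κ`. By `f-cover` it lies
  -- in the palette of `i` when `d = f h`, and in that of `next i`, rotated by one, when
  -- `d = suc (f h)`.
  covers : ∀ i → toℕ i < k → Covers i
  covers i i<k j j≢ with shift-surjective (ι≤k i) (toℕ<n j)
  ... | d , d<k , eq = lemma (f-cover κ≤2t+1 d (n≢0⇒n>0 d≢0) (≤-pred d<k))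
    where
    σd≡j : σ i d ≡ j
    σd≡j = toℕ-injective (trans (toℕ-σ i d) eq)
    d≢0 : d ≢ 0
    d≢0 refl = j≢ (sym σd≡j)
    lemma : ∃[ h ] (h ≤ t × (f h ≡ d ⊎ suc (f h) ≡ d)) →
            ∃[ h ] (h ≤ t × (σ i (f h) ≡ j ⊎ σ (next i) (f h) ≡ j))
    lemma (h , h≤t , inj₁ fh) = h , h≤t , inj₁ (trans (cong (σ i) fh) σd≡j)
    lemma (h , h≤t , inj₂ fh) = h , h≤t ,
      inj₂ (trans (σ-next-< (f h) i<k) (trans (cong (σ i) fh) σd≡j))

  bColoring : HasBColoring (cycle n n>2 ⊡ cycle t t>2) k
  bColoring = colour , (λ {v} {w} → proper v w) , λ j →
    let j<n = <-≤-trans (toℕ<n j) k≤n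
        i<k = subst (_< k) (sym (toℕ-fromℕ< j<n)) (toℕ<n j)
        i   = fromℕ< j<n
    in edgeVertex i , trans (colour-edgeVertex i) (σ-zero i<k (toℕ-fromℕ< j<n)) ,
       edgeVertex-bVertex i (covers i i<k)
    where
    σ-zero : ∀ {i j} → toℕ i < k → toℕ i ≡ toℕ j → σ i 0 ≡ j
    σ-zero {i} {j} i<k i≡j = toℕ-injective (begin
      toℕ (σ i 0)    ≡⟨ toℕ-σ i 0 ⟩
      (ι i + 0) % k  ≡⟨ cong (_% k) (+-identityʳ (ι i)) ⟩
      ι i % k        ≡⟨ cong (_% k) (trans (ι-< i<k) i≡j) ⟩
      toℕ j % k      ≡⟨ m<n⇒m%n≡m (toℕ<n j) ⟩
      toℕ j          ∎)
      where open ≡-Reasoning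

theorem12 : (n t : ℕ) (n>2 : 2 < n) (t>2 : 2 < t) →
    ((n ≡ 3 ⊎ n ≡ 4) → HasBChromaticNumber (cycle n n>2 ⊡ cycle t t>2) 5) ×
    ((5 ≤ n × n ≤ 2 * t + 2) → HasBChromaticNumber (cycle n n>2 ⊡ cycle t t>2) n) ×
    (¬ (n ≡ 3 ⊎ n ≡ 4) → ¬ (5 ≤ n × n ≤ 2 * t + 2) → HasBChromaticNumber (cycle n n>2 ⊡ cycle t t>2) (2 * t + 3))
theorem12 n t n>2 t>2 = small , middle , large
  where
  open UpperBound n>2 t>2 using (bColoring-≤)

  HasBChromaticNumber′ : ℕ → Set
  HasBChromaticNumber′ = HasBChromaticNumber (cycle n n>2 ⊡ cycle t t>2)

  lower : ∀ {k} → 5 ≤ k → k ≤ 2 * t + 3 → k ≤ n → HasBColoring (cycle n n>2 ⊡ cycle t t>2) k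
  lower {suc (suc κ)} (s≤s (s≤s 3≤κ)) k≤2t+3 k≤n = Rotation.bColoring n>2 t>2 3≤κ
    -- With `k = 2 + κ`, the bound `k ≤ 2 * t + 3` becomes the `κ ≤ suc (t + t)` that `f-cover`
    -- needs to fit `t + 1` positions.
    (+-cancelˡ-≤ 2 κ (suc (t + t)) (subst (2 + κ ≤_) (arith t) k≤2t+3)) k≤n
    where
    arith : ∀ t → 2 * t + 3 ≡ 3 + (t + t)
    arith = solve-∀

  small : n ≡ 3 ⊎ n ≡ 4 → HasBChromaticNumber′ 5
  small n≡3∨4 = coloring n>2 n≡3∨4 ,
    λ l b → [ (λ l≤5 → l≤5) , (λ p → ≤-trans (proj₁ p) (n≤5 n≡3∨4)) ]′ (bColoring-≤ b)
    where
    coloring : ∀ {n} (n>2 : 2 < n) → n ≡ 3 ⊎ n ≡ 4 →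
               HasBColoring (cycle n n>2 ⊡ cycle t t>2) 5
    coloring n>2 (inj₁ refl) = bColoring-3 t>2 n>2
    coloring n>2 (inj₂ refl) = bColoring-4 t>2 n>2
    n≤5 : n ≡ 3 ⊎ n ≡ 4 → n ≤ 5
    n≤5 (inj₁ refl) = m≤m+n 3 2
    n≤5 (inj₂ refl) = m≤m+n 4 1

  middle : 5 ≤ n × n ≤ 2 * t + 2 → HasBChromaticNumber′ n
  middle (5≤n , n≤2t+2) =
    lower 5≤n (≤-trans n≤2t+2 (+-monoʳ-≤ (2 * t) (n≤1+n 2))) ≤-refl ,
    λ l b → [ (λ l≤5 → ≤-trans l≤5 5≤n) , proj₁ ]′ (bColoring-≤ b)

  large : ¬ (n ≡ 3 ⊎ n ≡ 4) → ¬ (5 ≤ n × n ≤ 2 * t + 2) → HasBChromaticNumber′ (2 * t + 3)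
  large n≢3,4 n≰ = lower 5≤ ≤-refl 2t+3≤n ,
    λ l b → [ (λ l≤5 → ≤-trans l≤5 5≤) , proj₂ ]′ (bColoring-≤ b)
    where
    5≤n : 5 ≤ n
    5≤n = ≤∧≢⇒< (≤∧≢⇒< n>2 (λ eq → n≢3,4 (inj₁ (sym eq))))
                (λ eq → n≢3,4 (inj₂ (sym eq)))
    2t+3≤n : 2 * t + 3 ≤ n
    2t+3≤n = subst (_≤ n) (sym (+-suc (2 * t) 2)) (≰⇒> (λ n≤2t+2 → n≰ (5≤n , n≤2t+2)))
    5≤ : 5 ≤ 2 * t + 3
    5≤ = +-monoˡ-≤ 3 (≤-trans (≤-trans (n≤1+n 2) t>2) (m≤m+n t (t + 0)))
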